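{- For all integers $n \geq 1$, either $X(Y(n)) = X(n) + Y(n)$ or $X(Y(n)) = X(n) + Y(n) - 1$.
   Context: The sequences $(X(n))_{n\ge 0}$ and $(Y(n))_{n\ge 0}$ of non-negative integers (OEIS A140100 and A140101) are defined recursively as follows. Start with $X(0)=0$, $Y(0)=0$, $X(1)=1$, $Y(1)=2$. For $n>1$, choose the least positive integers $Y(n)>X(n)$ such that neither $Y(n)$ nor $X(n)$ appears in $\{Y(k) : 1\le k<n\}$ or $\{X(k): 1\le k<n\}$, and such that $Y(n)-X(n)$ does not appear in $\{Y(k)-X(k): 1\le k<n\}$ or $\{Y(k)+X(k): 1\le k<n\}$. Here "least" means: call $(n,x,y)$ good if $y>x$ are positive integers satisfying all of these conditions with $(x,y)$ in place of $(X(n),Y(n))$; then $X(n)$ is the least $x$ such that $(n,x,y)$ is good for some $y$, and $Y(n)$ is the least $y$ such that $(n,X(n),y)$ is good. First values for $n=0,1,2,\ldots$: $X = 0,1,3,4,6,7,9,10,12,14,15,\ldots$ and $Y = 0,2,5,8,11,13,16,19,22,25,28,\ldots$. -}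

module Defs where

open import Data.Nat using (ℕ; zero; suc; _+_; _∸_; _≤_; _<_; z≤n; s≤s; _<?_; _≟_)
open import Data.Nat.Properties
open import Data.List using (List; []; _∷_; map)
open import Data.Nat.ListAction using (sum)
open import Data.List.Membership.Propositional using (_∈_; _∉_)
open import Data.List.Membership.DecPropositional _≟_ using (_∈?_)
open import Data.List.Relation.Unary.Any using (here; there)
open import Data.Product using (Σ; ∃₂; _×_; _,_; proj₁; proj₂)
open import Data.Sum using (inj₁; inj₂)
open import Data.Empty using (⊥-elim)
open import Relation.Nullary using (yes; no; ¬?; _×-dec_)
open import Relation.Unary using (Decidable)
open import Relation.Binary.PropositionalEquality using (_≡_; _≢_; refl; sym; subst)

-- v is not in { f k : 1 ≤ k < n }.
NotIn : (ℕ → ℕ) → ℕ → ℕ → Set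
NotIn f n v = ∀ k → 1 ≤ k → k < n → v ≢ f k

-- Truncated subtraction is the true difference at every place it is used
-- below: x < y is required of candidates, and IsGreedy forces X k < Y k for
-- all k ≥ 1.
record Good (X Y : ℕ → ℕ) (n x y : ℕ) : Set where
  field
    x-positive : 0 < x
    x<y        : x < y
    x∉X        : NotIn X n x
    x∉Y        : NotIn Y n x
    y∉X        : NotIn X n y
    y∉Y        : NotIn Y n y
    diff∉diffs : NotIn (λ k → Y k ∸ X k) n (y ∸ x)
    diff∉sums  : NotIn (λ k → Y k + X k) n (y ∸ x)

record IsGreedy (X Y : ℕ → ℕ) : Set where
  field
    X0      : X 0 ≡ 0
    Y0      : Y 0 ≡ 0
    X1      : X 1 ≡ 1
    Y1      : Y 1 ≡ 2
    good    : ∀ n → 1 < n → Good X Y n (X n) (Y n)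
    X-least : ∀ n → 1 < n → ∀ x y → Good X Y n x y → X n ≤ x
    Y-least : ∀ n → 1 < n → ∀ y → Good X Y n (X n) y → Y n ≤ y

-- The rest of this module shows that IsGreedy is inhabited: the recursion is
-- run on the list of the pairs (X k , Y k), 1 ≤ k < n, chosen so far.
private
  History : Set
  History = List (ℕ × ℕ)

  px py pd ps : ℕ × ℕ → ℕ
  px (x , y) = x
  py (x , y) = y
  pd (x , y) = y ∸ x
  ps (x , y) = y + x

  QX : History → ℕ → Set
  QX h x = 0 < x × x ∉ map px h × x ∉ map py h

  QY : History → ℕ → ℕ → Set
  QY h x y = x < y × y ∉ map px h × y ∉ map py h
           × (y ∸ x) ∉ map pd h × (y ∸ x) ∉ map ps h

  QX? : ∀ h → Decidable (QX h)
  QX? h x = (0 <? x) ×-dec ¬? (x ∈? map px h) ×-dec ¬? (x ∈? map py h)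

  QY? : ∀ h x → Decidable (QY h x)
  QY? h x y = (x <? y) ×-dec ¬? (y ∈? map px h) ×-dec ¬? (y ∈? map py h)
            ×-dec ¬? ((y ∸ x) ∈? map pd h) ×-dec ¬? ((y ∸ x) ∈? map ps h)

  Least : (ℕ → Set) → Set
  Least P = Σ ℕ λ m → P m × (∀ k → P k → m ≤ k)

  least : ∀ {P : ℕ → Set} → Decidable P → ∀ n → P n → Least P
  least P? n pn with P? 0
  least P? n       pn | yes p = 0 , p , λ _ _ → z≤n
  least P? zero    pn | no ¬p = ⊥-elim (¬p pn)
  least {P} P? (suc n) pn | no ¬p with least (λ k → P? (suc k)) n pn
  ... | m , pm , min = suc m , pm , above
    where
    above : ∀ k → P k → suc m ≤ k
    above zero    p = ⊥-elim (¬p p)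
    above (suc k) p = s≤s (min k p)

  ∈⇒≤sum : ∀ {v} l → v ∈ l → v ≤ sum l
  ∈⇒≤sum (a ∷ l) (here refl) = m≤m+n a (sum l)
  ∈⇒≤sum (a ∷ l) (there i)   = ≤-trans (∈⇒≤sum l i) (m≤n+m (sum l) a)

  big∉ : ∀ {v} l → sum l < v → v ∉ l
  big∉ l lt i = <⇒≱ lt (∈⇒≤sum l i)

  stepX : ∀ h → Least (QX h)
  stepX h = least (QX? h) (suc (a + b))
    ( s≤s z≤n
    , big∉ (map px h) (s≤s (m≤m+n a b))
    , big∉ (map py h) (s≤s (m≤n+m b a)))
    where
    a = sum (map px h)
    b = sum (map py h)

  stepY : ∀ h x → Least (QY h x)
  stepY h x = least (QY? h x) (x + suc w)
    ( m<m+n x (s≤s z≤n)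
    , big∉ (map px h) (≤-trans (s≤s a≤w) (m≤n+m (suc w) x))
    , big∉ (map py h) (≤-trans (s≤s b≤w) (m≤n+m (suc w) x))
    , big∉ (map pd h) (subst (c <_) (sym (m+n∸m≡n x (suc w))) (s≤s c≤w))
    , big∉ (map ps h) (subst (d <_) (sym (m+n∸m≡n x (suc w))) (s≤s d≤w)))
    where
    a = sum (map px h)
    b = sum (map py h)
    c = sum (map pd h)
    d = sum (map ps h)
    w = (a + b) + (c + d)
    a≤w : a ≤ w
    a≤w = ≤-trans (m≤m+n a b) (m≤m+n (a + b) (c + d))
    b≤w : b ≤ w
    b≤w = ≤-trans (m≤n+m b a) (m≤m+n (a + b) (c + d))
    c≤w : c ≤ w
    c≤w = ≤-trans (m≤m+n c d) (m≤n+m (c + d) (a + b))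
    d≤w : d ≤ w
    d≤w = ≤-trans (m≤n+m d c) (m≤n+m (c + d) (a + b))

  step : History → ℕ × ℕ
  step h = proj₁ (stepX h) , proj₁ (stepY h (proj₁ (stepX h)))

  hist : ℕ → History
  hist zero    = []
  hist (suc n) = step (hist n) ∷ hist n

  term : ℕ → ℕ × ℕ
  term zero    = 0 , 0
  term (suc n) = step (hist n)

  ∉⇒NotIn : ∀ (p : ℕ × ℕ → ℕ) n {v} → v ∉ map p (hist n) →
            NotIn (λ k → p (term k)) (suc n) v
  ∉⇒NotIn p zero    ∉h (suc k) 1≤k (s≤s ())  eq
  ∉⇒NotIn p (suc n) ∉h k       1≤k (s≤s k≤n) eq with m≤n⇒m<n∨m≡n k≤n
  ... | inj₁ k<n  = ∉⇒NotIn p n (λ i → ∉h (there i)) k 1≤k k<n eq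
  ... | inj₂ refl = ∉h (here eq)

  NotIn⇒∉ : ∀ (p : ℕ × ℕ → ℕ) n {v} → NotIn (λ k → p (term k)) (suc n) v →
            v ∉ map p (hist n)
  NotIn⇒∉ p (suc n) ni (here eq) = ni (suc n) (s≤s z≤n) ≤-refl eq
  NotIn⇒∉ p (suc n) ni (there i) =
    NotIn⇒∉ p n (λ k 1≤k k<n → ni k 1≤k (m<n⇒m<1+n k<n)) i

  X₀ Y₀ : ℕ → ℕ
  X₀ n = px (term n)
  Y₀ n = py (term n)

  toGood : ∀ n {x y} → QX (hist n) x → QY (hist n) x y → Good X₀ Y₀ (suc n) x y
  toGood n (pos , xx , xy) (lt , yx , yy , dd , ds) = record
    { x-positive = pos
    ; x<y        = lt
    ; x∉X        = ∉⇒NotIn px n xx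
    ; x∉Y        = ∉⇒NotIn py n xy
    ; y∉X        = ∉⇒NotIn px n yx
    ; y∉Y        = ∉⇒NotIn py n yy
    ; diff∉diffs = ∉⇒NotIn pd n dd
    ; diff∉sums  = ∉⇒NotIn ps n ds
    }

  goodX : ∀ n {x y} → Good X₀ Y₀ (suc n) x y → QX (hist n) x
  goodX n g = x-positive , NotIn⇒∉ px n x∉X , NotIn⇒∉ py n x∉Y
    where open Good g

  goodY : ∀ n {x y} → Good X₀ Y₀ (suc n) x y → QY (hist n) x y
  goodY n g = x<y , NotIn⇒∉ px n y∉X , NotIn⇒∉ py n y∉Y
            , NotIn⇒∉ pd n diff∉diffs , NotIn⇒∉ ps n diff∉sums
    where open Good g

greedy-exists : ∃₂ IsGreedy
greedy-exists = X₀ , Y₀ , record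
  { X0      = refl
  ; Y0      = refl
  ; X1      = refl
  ; Y1      = refl
  ; good    = λ { (suc n) _ → toGood n (proj₁ (proj₂ (stepX (hist n))))
                                       (proj₁ (proj₂ (stepY (hist n) (X₀ (suc n))))) }
  ; X-least = λ { (suc n) _ x y g → proj₂ (proj₂ (stepX (hist n))) x (goodX n g) }
  ; Y-least = λ { (suc n) _ y g →
                  proj₂ (proj₂ (stepY (hist n) (X₀ (suc n)))) y (goodY n g) }
  }

{-# OPTIONS --safe #-}
-- Let t be the Tribonacci word, the fixed point of σ : a ↦ ab, b ↦ ac, c ↦ a, and
-- let ♯ l n be the number of letters l among its first n letters.  The greedy rule
-- says that X is the increasing complement of Y, and D = Y − X that of S = Y + X.
-- By the Lambek–Moser theorem, counting the a's of t and counting its b's give two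
-- complementary pairs, and the identities ♯ a (σ∣ n) = n, ♯ b (σ∣ n) = ♯ a n for the
-- length σ∣ n of the image of the first n letters show that they fit together, so
-- that X (n + 1) = 1 + n + ♯ a n and Y (n + 1) = 2 + n + σ∣ n.
--
-- It remains to see that the prefix of t of length 1 + n + σ∣ n contains n + ♯ a n or
-- n + ♯ a n + 1 letters a.  A five-vertex transducer reads t and writes t without
-- its first letter: it writes 1 + |σ l| letters when it reads l, and each of its
-- edges lifts along σ to a path, which proves by induction on k that on input σᵏ(a)
-- it writes a word w with aw a prefix of t.  The number of a's is then read off the
-- vertex reached.

module Submission where

open import Defs
open import Data.Nat using (ℕ; zero; suc; _+_; _∸_; _≤_; _<_; z≤n; s≤s)
open import Data.Nat.Properties
open import Data.Nat.Induction using (<-rec)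
open import Data.Nat.ListAction using (sum)
open import Data.Nat.ListAction.Properties using (sum-++)
open import Data.Nat.Tactic.RingSolver using (solve-∀)
open import Data.List using (List; []; _∷_; _++_; _∷ʳ_; length; map; concatMap; take; drop)
open import Data.List.Properties
  using (++-assoc; ++-identityʳ; length-++; length-take; map-++; concatMap-++; take-all; take++drop≡id; ++-cancelˡ; ∷-injectiveˡ)
open import Data.Product using (∃; ∃₂; _×_; _,_; proj₁; proj₂)
open import Data.Sum using (_⊎_; inj₁; inj₂)
open import Data.Empty using (⊥-elim)
open import Relation.Binary.Definitions using (tri<; tri≈; tri>)
open import Relation.Binary.PropositionalEquality
open import Relation.Nullary using (¬_)

-- The Tribonacci word

data Letter : Set where
  a b c : Letter

Word : Set
Word = List Letter

σ : Letter → Word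
σ a = a ∷ b ∷ []
σ b = a ∷ c ∷ []
σ c = a ∷ []

σ* : Word → Word
σ* = concatMap σ

W : ℕ → Word
W zero    = a ∷ []
W (suc k) = σ* (W k)

-- Prefixes of the infinite word are reached through the nested words `W k`, so that applying `σ*`
-- only raises `k`.
Prefix : Word → Set
Prefix p = ∃₂ λ k s → W k ≡ p ++ s

-- The extension is kept nonempty so that lengths grow strictly; `σ` erases no letter, which carries
-- this to the next `k`.
W-suc : ∀ k → ∃₂ λ x r → W (suc k) ≡ W k ++ x ∷ r
W-suc zero    = b , [] , refl
W-suc (suc k) with W-suc k
... | x , r , eq with σ x in eqx
...   | []    = ⊥-elim (σ≢[] x eqx)
  where
  σ≢[] : ∀ x → σ x ≢ []
  σ≢[] a ()
  σ≢[] b ()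
  σ≢[] c ()
...   | y ∷ u = y , u ++ σ* r ,
  trans (cong σ* eq) (trans (concatMap-++ σ (W k) (x ∷ r)) (cong (λ z → W (suc k) ++ z ++ σ* r) eqx))

W-+ : ∀ j k → ∃ λ r → W (j + k) ≡ W k ++ r
W-+ zero    k = [] , sym (++-identityʳ (W k))
W-+ (suc j) k with W-+ j k | W-suc (j + k)
... | r , eq | x , r′ , eq′ = r ++ x ∷ r′ ,
  trans eq′ (trans (cong (_++ x ∷ r′) eq) (++-assoc (W k) r (x ∷ r′)))

k<length-W : ∀ k → k < length (W k)
k<length-W zero    = s≤s z≤n
k<length-W (suc k) with W-suc k
... | x , r , eq = begin-strict
  suc k                         ≤⟨ k<length-W k ⟩
  length (W k)                  <⟨ m<m+n (length (W k)) (s≤s z≤n) ⟩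
  length (W k) + suc (length r) ≡⟨ length-++ (W k) ⟨
  length (W k ++ x ∷ r)         ≡⟨ cong length eq ⟨
  length (W (suc k))            ∎
  where open ≤-Reasoning

take-++ : ∀ n (p q : Word) → n ≤ length p → take n (p ++ q) ≡ take n p
take-++ zero    p       q _         = refl
take-++ (suc n) (x ∷ p) q (s≤s n≤p) = cong (x ∷_) (take-++ n p q n≤p)

-- `W n` has more than `n` letters, so `take` yields exactly `n` of them and leaves one over for
-- `t n`.
pre : ℕ → Word
pre n = take n (W n)

length-pre : ∀ n → length (pre n) ≡ n
length-pre n = trans (length-take n (W n)) (m≤n⇒m⊓n≡m (<⇒≤ (k<length-W n)))

pre-Prefix : ∀ n → Prefix (pre n)
pre-Prefix n = n , drop n (W n) , sym (take++drop≡id n (W n))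

Prefix-++ˡ : ∀ p q → Prefix (p ++ q) → Prefix p
Prefix-++ˡ p q (k , s , eq) = k , q ++ s , trans eq (++-assoc p q s)

Prefix-σ* : ∀ p → Prefix p → Prefix (σ* p)
Prefix-σ* p (k , s , eq) = suc k , σ* s , trans (cong σ* eq) (concatMap-++ σ p s)

-- With `n` the length of `p`, both `W k` and `W n` are prefixes of `W (n + k)`, so their first `n`
-- letters agree.
Prefix⇒pre : ∀ p → Prefix p → p ≡ pre (length p)
Prefix⇒pre p (k , s , eq) with W-+ (length p) k | W-+ k (length p)
... | r , eq₁ | r′ , eq₂ = begin
  p                     ≡⟨ take-all n p ≤-refl ⟨
  take n p              ≡⟨ take-++ n p (s ++ r) ≤-refl ⟨
  take n (p ++ s ++ r)  ≡⟨ cong (take n) (++-assoc p s r) ⟨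
  take n ((p ++ s) ++ r) ≡⟨ cong (λ z → take n (z ++ r)) eq ⟨
  take n (W k ++ r)     ≡⟨ cong (take n) eq₁ ⟨
  take n (W (n + k))    ≡⟨ cong (λ z → take n (W z)) (+-comm n k) ⟩
  take n (W (k + n))    ≡⟨ cong (take n) eq₂ ⟩
  take n (W n ++ r′)    ≡⟨ take-++ n (W n) r′ (<⇒≤ (k<length-W n)) ⟩
  pre n                 ∎
  where
  open ≡-Reasoning
  n = length p

pre-∷ʳ : ∀ n x → Prefix (pre n ∷ʳ x) → pre (suc n) ≡ pre n ∷ʳ x
pre-∷ʳ n x px = sym (subst (λ m → pre n ∷ʳ x ≡ pre m) len (Prefix⇒pre (pre n ∷ʳ x) px))
  where
  len : length (pre n ∷ʳ x) ≡ suc n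
  len = trans (length-++ (pre n)) (trans (cong (_+ 1) (length-pre n)) (+-comm n 1))

next : ∀ n → ∃ λ x → pre (suc n) ≡ pre n ∷ʳ x
next n with drop n (W n) in eq
... | x ∷ s = x , pre-∷ʳ n x (n , s , trans W≡ (sym (++-assoc (pre n) (x ∷ []) s)))
  where
  W≡ : W n ≡ pre n ++ x ∷ s
  W≡ = trans (sym (take++drop≡id n (W n))) (cong (pre n ++_) eq)
... | [] = ⊥-elim (<-irrefl (sym lenW) (k<length-W n))
  where
  lenW : length (W n) ≡ n
  lenW = trans (cong length (trans (sym (take++drop≡id n (W n)))
           (trans (cong (pre n ++_) eq) (++-identityʳ (pre n))))) (length-pre n)

t : ℕ → Letter
t n = proj₁ (next n)

pre-suc : ∀ n → pre (suc n) ≡ pre n ∷ʳ t n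
pre-suc n = proj₂ (next n)

t-unique : ∀ n x → Prefix (pre n ∷ʳ x) → t n ≡ x
t-unique n x px =
  ∷-injectiveˡ (++-cancelˡ (pre n) _ _ (trans (sym (pre-suc n)) (pre-∷ʳ n x px)))

-- Letter counts

δ : Letter → Letter → ℕ
δ a a = 1
δ b b = 1
δ c c = 1
δ _ _ = 0

count : Letter → Word → ℕ
count x p = sum (map (δ x) p)

count-++ : ∀ x p q → count x (p ++ q) ≡ count x p + count x q
count-++ x p q = trans (cong sum (map-++ (δ x) p q)) (sum-++ (map (δ x) p) (map (δ x) q))

length≡counts : ∀ p → length p ≡ count a p + count b p + count c p
length≡counts []      = refl
length≡counts (a ∷ p) = cong suc (length≡counts p)
length≡counts (b ∷ p) = trans (cong suc (length≡counts p)) (lem (count a p) (count b p) (count c p))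
  where
  lem : ∀ i j k → suc (i + j + k) ≡ i + suc j + k
  lem = solve-∀
length≡counts (c ∷ p) = trans (cong suc (length≡counts p)) (sym (+-suc _ _))

count-a-σ* : ∀ p → count a (σ* p) ≡ length p
count-a-σ* []      = refl
count-a-σ* (a ∷ p) = cong suc (count-a-σ* p)
count-a-σ* (b ∷ p) = cong suc (count-a-σ* p)
count-a-σ* (c ∷ p) = cong suc (count-a-σ* p)

count-b-σ* : ∀ p → count b (σ* p) ≡ count a p
count-b-σ* []      = refl
count-b-σ* (a ∷ p) = cong suc (count-b-σ* p)
count-b-σ* (b ∷ p) = count-b-σ* p
count-b-σ* (c ∷ p) = count-b-σ* p

count-c-σ* : ∀ p → count c (σ* p) ≡ count b p
count-c-σ* []      = refl
count-c-σ* (a ∷ p) = count-c-σ* p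
count-c-σ* (b ∷ p) = cong suc (count-c-σ* p)
count-c-σ* (c ∷ p) = count-c-σ* p

♯ : Letter → ℕ → ℕ
♯ x n = count x (pre n)

♯-suc : ∀ x n → ♯ x (suc n) ≡ δ x (t n) + ♯ x n
♯-suc x n = begin
  count x (pre (suc n))           ≡⟨ cong (count x) (pre-suc n) ⟩
  count x (pre n ∷ʳ t n)          ≡⟨ count-++ x (pre n) (t n ∷ []) ⟩
  ♯ x n + (δ x (t n) + 0)         ≡⟨ cong (♯ x n +_) (+-identityʳ _) ⟩
  ♯ x n + δ x (t n)               ≡⟨ +-comm (♯ x n) _ ⟩
  δ x (t n) + ♯ x n               ∎
  where open ≡-Reasoning

n≡♯ : ∀ n → n ≡ ♯ a n + ♯ b n + ♯ c n
n≡♯ n = trans (sym (length-pre n)) (length≡counts (pre n))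

-- The position at which the image of the letter t n starts in t = σ* t.
σ∣ : ℕ → ℕ
σ∣ n = length (σ* (pre n))

pre-σ∣ : ∀ n → σ* (pre n) ≡ pre (σ∣ n)
pre-σ∣ n = Prefix⇒pre _ (Prefix-σ* (pre n) (pre-Prefix n))

♯a-σ∣ : ∀ n → ♯ a (σ∣ n) ≡ n
♯a-σ∣ n = trans (cong (count a) (sym (pre-σ∣ n))) (trans (count-a-σ* (pre n)) (length-pre n))

♯b-σ∣ : ∀ n → ♯ b (σ∣ n) ≡ ♯ a n
♯b-σ∣ n = trans (cong (count b) (sym (pre-σ∣ n))) (count-b-σ* (pre n))

♯c-σ∣ : ∀ n → ♯ c (σ∣ n) ≡ ♯ b n
♯c-σ∣ n = trans (cong (count c) (sym (pre-σ∣ n))) (count-c-σ* (pre n))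

-- Each image contributes one a, the image of an a also one b, and the image of a b also one c.
σ∣≡ : ∀ n → σ∣ n ≡ n + ♯ a n + ♯ b n
σ∣≡ n = trans (n≡♯ (σ∣ n)) (cong₂ _+_ (cong₂ _+_ (♯a-σ∣ n) (♯b-σ∣ n)) (♯c-σ∣ n))

-- Desubstitution of positions

σ*-pre-suc : ∀ n → σ* (pre (suc n)) ≡ pre (σ∣ n) ++ σ (t n)
σ*-pre-suc n = begin
  σ* (pre (suc n))               ≡⟨ cong σ* (pre-suc n) ⟩
  σ* (pre n ∷ʳ t n)              ≡⟨ concatMap-++ σ (pre n) (t n ∷ []) ⟩
  σ* (pre n) ++ (σ (t n) ++ [])  ≡⟨ cong₂ _++_ (pre-σ∣ n) (++-identityʳ _) ⟩
  pre (σ∣ n) ++ σ (t n)          ∎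
  where open ≡-Reasoning

σ∣-suc : ∀ n → σ∣ (suc n) ≡ length (σ (t n)) + σ∣ n
σ∣-suc n = begin
  length (σ* (pre (suc n)))               ≡⟨ cong length (σ*-pre-suc n) ⟩
  length (pre (σ∣ n) ++ σ (t n))          ≡⟨ length-++ (pre (σ∣ n)) ⟩
  length (pre (σ∣ n)) + length (σ (t n))  ≡⟨ cong (_+ length (σ (t n))) (length-pre (σ∣ n)) ⟩
  σ∣ n + length (σ (t n))                 ≡⟨ +-comm (σ∣ n) _ ⟩
  length (σ (t n)) + σ∣ n                 ∎
  where open ≡-Reasoning

image-Prefix : ∀ n → Prefix (pre (σ∣ n) ++ σ (t n))
image-Prefix n = subst Prefix (σ*-pre-suc n) (Prefix-σ* _ (pre-Prefix (suc n)))

t-σ∣ : ∀ n → t (σ∣ n) ≡ a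
t-σ∣ n with t n | image-Prefix n
... | a | P = t-unique (σ∣ n) a (Prefix-++ˡ _ (b ∷ []) (subst Prefix (sym (++-assoc (pre (σ∣ n)) _ _)) P))
... | b | P = t-unique (σ∣ n) a (Prefix-++ˡ _ (c ∷ []) (subst Prefix (sym (++-assoc (pre (σ∣ n)) _ _)) P))
... | c | P = t-unique (σ∣ n) a P

t-suc-σ∣ : ∀ n x → σ (t n) ≡ a ∷ x ∷ [] → t (suc (σ∣ n)) ≡ x
t-suc-σ∣ n x eq = t-unique (suc (σ∣ n)) x (subst Prefix pre≡ (image-Prefix n))
  where
  pre≡ : pre (σ∣ n) ++ σ (t n) ≡ pre (suc (σ∣ n)) ∷ʳ x
  pre≡ = begin
    pre (σ∣ n) ++ σ (t n)               ≡⟨ cong (pre (σ∣ n) ++_) eq ⟩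
    pre (σ∣ n) ++ a ∷ x ∷ []            ≡⟨ ++-assoc (pre (σ∣ n)) _ _ ⟨
    (pre (σ∣ n) ∷ʳ a) ∷ʳ x              ≡⟨ cong (λ y → (pre (σ∣ n) ∷ʳ y) ∷ʳ x) (t-σ∣ n) ⟨
    (pre (σ∣ n) ∷ʳ t (σ∣ n)) ∷ʳ x       ≡⟨ cong (_∷ʳ x) (pre-suc (σ∣ n)) ⟨
    pre (suc (σ∣ n)) ∷ʳ x               ∎
    where open ≡-Reasoning

-- Every position of `t` is the first or second letter of an image. The constructor names the letter
-- there: a comes first, and the second letter is b in `σ a`, c in `σ b`.
data Desubstitution : ℕ → Set where
  at-a : ∀ n → Desubstitution (σ∣ n)
  at-b : ∀ n → t n ≡ a → Desubstitution (suc (σ∣ n))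
  at-c : ∀ n → t n ≡ b → Desubstitution (suc (σ∣ n))

desubstitute : ∀ m → Desubstitution m
desubstitute zero = at-a 0
desubstitute (suc m) with desubstitute m
... | at-b n tn = subst Desubstitution (trans (σ∣-suc n) (cong (λ x → length (σ x) + σ∣ n) tn)) (at-a (suc n))
... | at-c n tn = subst Desubstitution (trans (σ∣-suc n) (cong (λ x → length (σ x) + σ∣ n) tn)) (at-a (suc n))
... | at-a n with t n in tn
...   | a = at-b n tn
...   | b = at-c n tn
...   | c = subst Desubstitution (trans (σ∣-suc n) (cong (λ x → length (σ x) + σ∣ n) tn)) (at-a (suc n))

-- The transducer

data Vertex : Set where
  v₀ v₁ v₂ v₃ v₄ : Vertex

-- The indices are source, target, letter read and word written. The relation is nondeterministic:
-- `v₀` has five edges reading a, and only the existence of a suitable path matters.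
data Edge : Vertex → Vertex → Letter → Word → Set where
  e₁  : Edge v₀ v₀ a (a ∷ b ∷ a ∷ [])
  e₂  : Edge v₀ v₀ a (b ∷ a ∷ a ∷ [])
  e₃  : Edge v₀ v₀ c (c ∷ a ∷ [])
  e₄  : Edge v₀ v₁ a (b ∷ a ∷ c ∷ [])
  e₅  : Edge v₀ v₂ a (b ∷ a ∷ b ∷ [])
  e₆  : Edge v₀ v₃ a (c ∷ a ∷ b ∷ [])
  e₇  : Edge v₀ v₄ b (b ∷ a ∷ c ∷ [])
  e₈  : Edge v₁ v₀ b (a ∷ b ∷ a ∷ [])
  e₉  : Edge v₁ v₂ c (a ∷ b ∷ [])
  e₁₀ : Edge v₂ v₀ b (a ∷ c ∷ a ∷ [])
  e₁₁ : Edge v₂ v₂ a (a ∷ a ∷ b ∷ [])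
  e₁₂ : Edge v₃ v₀ b (a ∷ b ∷ a ∷ [])
  e₁₃ : Edge v₃ v₀ c (a ∷ a ∷ [])
  e₁₄ : Edge v₄ v₀ a (a ∷ b ∷ a ∷ [])

infixr 5 _◅_

data Path : Vertex → Vertex → Word → Word → Set where
  ε   : ∀ {v} → Path v v [] []
  _◅_ : ∀ {u v w x q p r} → Edge u v x q → Path v w p r → Path u w (x ∷ p) (q ++ r)

_◅◅_ : ∀ {u v w p q p′ q′} → Path u v p q → Path v w p′ q′ → Path u w (p ++ p′) (q ++ q′)
ε ◅◅ π = π
_◅◅_ {q′ = q′} (_◅_ {q = q} {r = r} e ρ) π =
  subst (Path _ _ _) (sym (++-assoc q r q′)) (e ◅ (ρ ◅◅ π))

-- Used to stop the path on `W n` after `n` letters, at whatever vertex it has then reached.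
split : ∀ p {v w s q} → Path v w (p ++ s) q → ∃₂ λ u q₁ → ∃ λ q₂ → Path v u p q₁ × q ≡ q₁ ++ q₂
split []      {v} {q = q} π = v , [] , q , ε , refl
split (x ∷ p) (_◅_ {q = q} e π) with split p π
... | u , q₁ , q₂ , ρ , eq = u , q ++ q₁ , q₂ , e ◅ ρ ,
  trans (cong (q ++_) eq) (sym (++-assoc q q₁ q₂))

-- The vertex map of the lifting. It fixes `v₀`, so lifts of paths from `v₀` start at `v₀` again.
φ : Vertex → Vertex
φ v₀ = v₀
φ v₁ = v₀
φ v₂ = v₀
φ v₃ = v₄
φ v₄ = v₂

τ : Vertex → Word
τ v₀ = b ∷ []
τ v₁ = []
τ v₂ = c ∷ []
τ v₃ = []
τ v₄ = a ∷ []

-- Lifting conjugates the output: at v, σ* of the output so far is ahead of the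
-- output of the lifted path by the word τ v.
lift : ∀ {v w x q} → Edge v w x q →
  ∃ λ r → Path (φ v) (φ w) (σ x) r × r ++ τ w ≡ τ v ++ σ* q
lift e₁  = _ , e₅ ◅ e₁₀ ◅ ε , refl
lift e₂  = _ , e₄ ◅ e₈ ◅ ε , refl
lift e₃  = _ , e₂ ◅ ε , refl
lift e₄  = _ , e₄ ◅ e₈ ◅ ε , refl
lift e₅  = _ , e₄ ◅ e₈ ◅ ε , refl
lift e₆  = _ , e₂ ◅ e₇ ◅ ε , refl
lift e₇  = _ , e₄ ◅ e₉ ◅ ε , refl
lift e₈  = _ , e₁ ◅ e₃ ◅ ε , refl
lift e₉  = _ , e₁ ◅ ε , refl
lift e₁₀ = _ , e₆ ◅ e₁₃ ◅ ε , refl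
lift e₁₁ = _ , e₆ ◅ e₁₂ ◅ ε , refl
lift e₁₂ = _ , e₁₄ ◅ e₃ ◅ ε , refl
lift e₁₃ = _ , e₁₄ ◅ ε , refl
lift e₁₄ = _ , e₁₁ ◅ e₁₀ ◅ ε , refl

lift* : ∀ {v w p q} → Path v w p q →
  ∃ λ r → Path (φ v) (φ w) (σ* p) r × r ++ τ w ≡ τ v ++ σ* q
lift* {v} ε = [] , ε , sym (++-identityʳ (τ v))
lift* {v} {w} (_◅_ {v = u} {q = q} {r = r} e π) with lift e | lift* π
... | q′ , ρ , eq | r′ , ρ′ , eq′ = q′ ++ r′ , ρ ◅◅ ρ′ , (begin
  (q′ ++ r′) ++ τ w       ≡⟨ ++-assoc q′ r′ (τ w) ⟩
  q′ ++ r′ ++ τ w         ≡⟨ cong (q′ ++_) eq′ ⟩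
  q′ ++ τ u ++ σ* r       ≡⟨ ++-assoc q′ (τ u) (σ* r) ⟨
  (q′ ++ τ u) ++ σ* r     ≡⟨ cong (_++ σ* r) eq ⟩
  (τ v ++ σ* q) ++ σ* r   ≡⟨ ++-assoc (τ v) (σ* q) (σ* r) ⟩
  τ v ++ σ* q ++ σ* r     ≡⟨ cong (τ v ++_) (concatMap-++ σ q r) ⟨
  τ v ++ σ* (q ++ r)      ∎)
  where open ≡-Reasoning

path-W : ∀ k → ∃₂ λ w q → Path v₀ w (W k) q × Prefix (a ∷ q)
-- The letter a followed by this output is `W 2`.
path-W zero = v₁ , b ∷ a ∷ c ∷ [] , e₄ ◅ ε , 2 , [] , refl
path-W (suc k) with path-W k
... | w , q , π , P with lift* π
...   | r , ρ , eq = φ w , r , ρ ,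
  -- As `τ v₀` is the b of `σ a`, `σ* (a ∷ q)` is `a ∷ τ v₀ ++ σ* q`, that is, `a ∷ r ++ τ w`.
  Prefix-++ˡ (a ∷ r) (τ w) (subst Prefix (cong (a ∷_) (sym eq)) (Prefix-σ* (a ∷ q) P))

-- Counting the letter a along a path, with `h` as potential

h : Vertex → ℕ
h v₀ = 1
h v₁ = 0
h v₂ = 0
h v₃ = 0
h v₄ = 1

h≤1 : ∀ v → h v ≡ 0 ⊎ h v ≡ 1
h≤1 v₀ = inj₂ refl
h≤1 v₁ = inj₁ refl
h≤1 v₂ = inj₁ refl
h≤1 v₃ = inj₁ refl
h≤1 v₄ = inj₂ refl

edge-length : ∀ {v w x q} → Edge v w x q → length q ≡ 1 + length (σ x)
edge-length e₁  = refl
edge-length e₂  = refl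
edge-length e₃  = refl
edge-length e₄  = refl
edge-length e₅  = refl
edge-length e₆  = refl
edge-length e₇  = refl
edge-length e₈  = refl
edge-length e₉  = refl
edge-length e₁₀ = refl
edge-length e₁₁ = refl
edge-length e₁₂ = refl
edge-length e₁₃ = refl
edge-length e₁₄ = refl

-- The a's written exceed the letters read plus the a's read by `h w` minus `h v`, so the excess
-- telescopes along a path.
edge-count : ∀ {v w x q} → Edge v w x q → h v + count a q ≡ (1 + δ a x) + h w
edge-count e₁  = refl
edge-count e₂  = refl
edge-count e₃  = refl
edge-count e₄  = refl
edge-count e₅  = refl
edge-count e₆  = refl
edge-count e₇  = refl
edge-count e₈  = refl
edge-count e₉  = refl
edge-count e₁₀ = refl
edge-count e₁₁ = refl
edge-count e₁₂ = refl
edge-count e₁₃ = refl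
edge-count e₁₄ = refl

path-length : ∀ {v w p q} → Path v w p q → length q ≡ length p + length (σ* p)
path-length ε = refl
path-length (_◅_ {x = x} {q = q} {p = p} {r = r} e π) = begin
  length (q ++ r)                                             ≡⟨ length-++ q ⟩
  length q + length r                                         ≡⟨ cong₂ _+_ (edge-length e) (path-length π) ⟩
  (1 + length (σ x)) + (length p + length (σ* p))             ≡⟨ lem (length (σ x)) (length p) (length (σ* p)) ⟩
  (1 + length p) + (length (σ x) + length (σ* p))             ≡⟨ cong ((1 + length p) +_) (length-++ (σ x)) ⟨
  (1 + length p) + length (σ x ++ σ* p)                       ∎
  where
  open ≡-Reasoning
  lem : ∀ i j k → (1 + i) + (j + k) ≡ (1 + j) + (i + k)
  lem = solve-∀

path-count : ∀ {v w p q} → Path v w p q → h v + count a q ≡ (length p + count a p) + h w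
path-count {v} ε = +-identityʳ (h v)
path-count {v} {w} (_◅_ {v = u} {x = x} {q = q} {p = p} {r = r} e π) = begin
  h v + count a (q ++ r)                               ≡⟨ cong (h v +_) (count-++ a q r) ⟩
  h v + (count a q + count a r)                        ≡⟨ +-assoc (h v) _ _ ⟨
  (h v + count a q) + count a r                        ≡⟨ cong (_+ count a r) (edge-count e) ⟩
  ((1 + δ a x) + h u) + count a r                      ≡⟨ +-assoc (1 + δ a x) _ _ ⟩
  (1 + δ a x) + (h u + count a r)                      ≡⟨ cong ((1 + δ a x) +_) (path-count π) ⟩
  (1 + δ a x) + ((length p + count a p) + h w)         ≡⟨ lem (δ a x) (length p) (count a p) (h w) ⟩
  ((1 + length p) + (δ a x + count a p)) + h w         ∎
  where
  open ≡-Reasoning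
  lem : ∀ i j k l → (1 + i) + ((j + k) + l) ≡ ((1 + j) + (i + k)) + l
  lem = solve-∀

♯a-1+n+σ∣n : ∀ n → ∃ λ v → ♯ a (1 + n + σ∣ n) ≡ (n + ♯ a n) + h v
♯a-1+n+σ∣n n with path-W n
... | w , q , π , P with split (pre n) (subst (λ p → Path v₀ w p q) (sym (take++drop≡id n (W n))) π)
...   | v , q₁ , q₂ , ρ , refl = v , (begin
  ♯ a (1 + n + σ∣ n)                        ≡⟨ cong (♯ a) len ⟨
  count a (pre (length (a ∷ q₁)))           ≡⟨ cong (count a) (Prefix⇒pre (a ∷ q₁) (Prefix-++ˡ (a ∷ q₁) q₂ P)) ⟨
  -- The leading a supplies `h v₀`, which is 1.
  1 + count a q₁                            ≡⟨ path-count ρ ⟩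
  (length (pre n) + ♯ a n) + h v            ≡⟨ cong (λ m → (m + ♯ a n) + h v) (length-pre n) ⟩
  (n + ♯ a n) + h v                         ∎)
  where
  open ≡-Reasoning
  len : length (a ∷ q₁) ≡ 1 + n + σ∣ n
  len = cong suc (trans (path-length ρ) (cong (_+ σ∣ n) (length-pre n)))

-- Lambek–Moser complementarity: cnt m is the number of marked positions below m,
-- and upper j is the value that lower skips at the marked position number j
-- (counting from 0).
module Complementary
  (cnt upper : ℕ → ℕ)
  (cnt-zero : cnt 0 ≡ 0)
  (cnt-suc  : ∀ m → cnt (suc m) ≡ cnt m ⊎
                    (cnt (suc m) ≡ suc (cnt m) × upper (cnt m) ≡ suc (suc (m + cnt m))))
  (marked   : ∀ j → ∃ λ m → cnt (suc m) ≡ suc (cnt m) × upper j ≡ suc (suc (m + cnt m)))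
  where

  lower : ℕ → ℕ
  lower m = suc (m + cnt m)

  lower-suc-unmarked : ∀ m → cnt (suc m) ≡ cnt m → lower (suc m) ≡ suc (lower m)
  lower-suc-unmarked m eq = cong (λ k → 2 + (m + k)) eq

  lower-suc-marked : ∀ m → cnt (suc m) ≡ suc (cnt m) → lower (suc m) ≡ 2 + lower m
  lower-suc-marked m eq = cong (2 +_) (trans (cong (m +_) eq) (+-suc m (cnt m)))

  lower-<-suc : ∀ m → lower m < lower (suc m)
  lower-<-suc m with cnt-suc m
  ... | inj₁ eq       = ≤-reflexive (sym (lower-suc-unmarked m eq))
  ... | inj₂ (eq , _) = ≤-trans (n≤1+n _) (≤-reflexive (sym (lower-suc-marked m eq)))

  lower-mono-< : ∀ {m n} → m < n → lower m < lower n
  lower-mono-< {m} {suc n} (s≤s m≤n) with m≤n⇒m<n∨m≡n m≤n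
  ... | inj₁ m<n  = <-trans (lower-mono-< m<n) (lower-<-suc n)
  ... | inj₂ refl = lower-<-suc m

  lower-mono-≤ : ∀ {m n} → m ≤ n → lower m ≤ lower n
  lower-mono-≤ m≤n with m≤n⇒m<n∨m≡n m≤n
  ... | inj₁ m<n  = <⇒≤ (lower-mono-< m<n)
  ... | inj₂ refl = ≤-refl

  -- At a marked `m`, `lower` jumps by 2 and `upper j` is the value jumped over; monotonicity
  -- excludes all other `i`.
  lower≢upper : ∀ i j → lower i ≢ upper j
  lower≢upper i j eq with marked j
  ... | m , cnt≡ , upper≡ with ≤-<-connex i m
  ...   | inj₁ i≤m = <⇒≢ (s≤s (lower-mono-≤ i≤m)) (trans eq upper≡)
  ...   | inj₂ m<i = <⇒≢ (≤-trans (≤-reflexive (sym (lower-suc-marked m cnt≡))) (lower-mono-≤ m<i))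
                         (sym (trans eq upper≡))

  cnt≤ : ∀ m → cnt m ≤ m
  cnt≤ zero    = ≤-reflexive cnt-zero
  cnt≤ (suc m) with cnt-suc m
  ... | inj₁ eq       = ≤-trans (≤-reflexive eq) (≤-trans (cnt≤ m) (n≤1+n m))
  ... | inj₂ (eq , _) = ≤-trans (≤-reflexive eq) (s≤s (cnt≤ m))

  -- Only `upper (cnt n)` can lie strictly between `lower n` and `lower (suc n)`, and `cnt n` is at
  -- most `n`. The bound on `k` serves minimality: smaller values are already taken.
  cover : ∀ n v → 0 < v → v < lower n → ∃ λ k → k < n × (v ≡ lower k ⊎ v ≡ upper k)
  cover zero    v 0<v v<1 = ⊥-elim (<⇒≱ 0<v (≤-pred (≤-trans v<1 (s≤s (≤-reflexive cnt-zero)))))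
  cover (suc n) v 0<v v<  with <-cmp v (lower n)
  ... | tri≈ _ eq _ = n , ≤-refl , inj₁ eq
  ... | tri< lt _ _ with cover n v 0<v lt
  ...   | k , k<n , eq = k , m<n⇒m<1+n k<n , eq
  cover (suc n) v 0<v v<  | tri> _ _ gt with cnt-suc n
  ...   | inj₁ eq = ⊥-elim (<⇒≱ gt (≤-pred (≤-trans v< (≤-reflexive (lower-suc-unmarked n eq)))))
  ...   | inj₂ (eq , upper≡) = cnt n , s≤s (cnt≤ n) , inj₂ (trans v≡ (sym upper≡))
    where
    v≡ : v ≡ suc (lower n)
    v≡ = ≤-antisym (≤-pred (≤-trans v< (≤-reflexive (lower-suc-marked n eq)))) gt

-- Closed forms of X (suc n), Y (suc n), Y (suc n) ∸ X (suc n) and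
-- Y (suc n) + X (suc n).
x y d s : ℕ → ℕ
x n = suc (n + ♯ a n)
y n = suc (suc (n + σ∣ n))
d n = suc (n + ♯ b n)
s n = 3 + (n + σ∣ (σ∣ n))

y≡x+d : ∀ n → y n ≡ x n + d n
y≡x+d n = trans (cong (λ m → 2 + (n + m)) (σ∣≡ n)) (lem n (♯ a n) (♯ b n))
  where
  lem : ∀ n i j → 2 + (n + (n + i + j)) ≡ suc (n + i) + suc (n + j)
  lem = solve-∀

s≡y+x : ∀ n → s n ≡ y n + x n
s≡y+x n = begin
  3 + (n + σ∣ (σ∣ n))                             ≡⟨ cong (λ m → 3 + (n + m)) (σ∣≡ (σ∣ n)) ⟩
  3 + (n + (σ∣ n + ♯ a (σ∣ n) + ♯ b (σ∣ n)))      ≡⟨ cong₂ (λ i j → 3 + (n + (σ∣ n + i + j))) (♯a-σ∣ n) (♯b-σ∣ n) ⟩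
  3 + (n + (σ∣ n + n + ♯ a n))                    ≡⟨ lem n (σ∣ n) (♯ a n) ⟩
  y n + x n                                       ∎
  where
  open ≡-Reasoning
  lem : ∀ n i j → 3 + (n + (i + n + j)) ≡ suc (suc (n + i)) + suc (n + j)
  lem = solve-∀

-- The letters a mark the values skipped by `x`, the letters b those skipped by `d`

y≡suc-x : ∀ n → y n ≡ suc (x (σ∣ n))
y≡suc-x n = cong (2 +_) (trans (+-comm n (σ∣ n)) (cong (σ∣ n +_) (sym (♯a-σ∣ n))))

♯b-suc-σ∣ : ∀ n → ♯ b (suc (σ∣ n)) ≡ ♯ a n
♯b-suc-σ∣ n = trans (♯-suc b (σ∣ n)) (trans (cong (λ l → δ b l + ♯ b (σ∣ n)) (t-σ∣ n)) (♯b-σ∣ n))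

-- The a number `n` of `t`, counted from 0, is at `σ∣ n`; the second letter of its image is the b
-- number `n`.
s≡suc-d : ∀ n → s n ≡ suc (d (suc (σ∣ (σ∣ n))))
s≡suc-d n = cong (3 +_) (trans (+-comm n _) (cong (σ∣ (σ∣ n) +_)
  (sym (trans (♯b-suc-σ∣ (σ∣ n)) (♯a-σ∣ n)))))

t-suc-σ∣-a : ∀ n → t n ≡ a → t (suc (σ∣ n)) ≡ b
t-suc-σ∣-a n eq = t-suc-σ∣ n b (cong σ eq)

t-suc-σ∣-b : ∀ n → t n ≡ b → t (suc (σ∣ n)) ≡ c
t-suc-σ∣-b n eq = t-suc-σ∣ n c (cong σ eq)

♯-suc-at : ∀ l n {l′} → t n ≡ l′ → ♯ l (suc n) ≡ δ l l′ + ♯ l n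
♯-suc-at l n eq = trans (♯-suc l n) (cong (λ l′ → δ l l′ + ♯ l n) eq)

x-step : ∀ m → ♯ a (suc m) ≡ ♯ a m ⊎ (♯ a (suc m) ≡ suc (♯ a m) × y (♯ a m) ≡ suc (x m))
x-step m with desubstitute m
... | at-a n    = inj₂ (♯-suc-at a m (t-σ∣ n) , trans (cong y (♯a-σ∣ n)) (y≡suc-x n))
... | at-b n tn = inj₁ (♯-suc-at a m (t-suc-σ∣-a n tn))
... | at-c n tn = inj₁ (♯-suc-at a m (t-suc-σ∣-b n tn))

x-mark : ∀ j → ∃ λ m → ♯ a (suc m) ≡ suc (♯ a m) × y j ≡ suc (x m)
x-mark j = σ∣ j , ♯-suc-at a (σ∣ j) (t-σ∣ j) , y≡suc-x j

module XY = Complementary (♯ a) y refl x-step x-mark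

-- An a at `n` forces `n` to be some `σ∣ r`, with `♯ a n` equal to `r`; otherwise `t n` would be b
-- or c.
s-♯a : ∀ n → t n ≡ a → s (♯ a n) ≡ suc (d (suc (σ∣ n)))
s-♯a n tn with desubstitute n
... | at-a r = trans (cong s (♯a-σ∣ r)) (s≡suc-d r)
... | at-b r tr with trans (sym tn) (t-suc-σ∣-a r tr)
...   | ()
s-♯a n tn | at-c r tr with trans (sym tn) (t-suc-σ∣-b r tr)
...   | ()

d-step : ∀ m → ♯ b (suc m) ≡ ♯ b m ⊎ (♯ b (suc m) ≡ suc (♯ b m) × s (♯ b m) ≡ suc (d m))
d-step m with desubstitute m
... | at-a n    = inj₁ (♯-suc-at b m (t-σ∣ n))
... | at-b n tn = inj₂ (♯-suc-at b m (t-suc-σ∣-a n tn) , trans (cong s (♯b-suc-σ∣ n)) (s-♯a n tn))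
... | at-c n tn = inj₁ (♯-suc-at b m (t-suc-σ∣-b n tn))

d-mark : ∀ j → ∃ λ m → ♯ b (suc m) ≡ suc (♯ b m) × s j ≡ suc (d m)
d-mark j = suc (σ∣ (σ∣ j)) , ♯-suc-at b (suc (σ∣ (σ∣ j))) (t-suc-σ∣-a (σ∣ j) (t-σ∣ j)) , s≡suc-d j

module DS = Complementary (♯ b) s refl d-step d-mark

x<y : ∀ n → x n < y n
x<y n = subst (x n <_) (sym (y≡x+d n)) (m<m+n (x n) (s≤s z≤n))

y∸x≡d : ∀ n → y n ∸ x n ≡ d n
y∸x≡d n = trans (cong (_∸ x n) (y≡x+d n)) (m+n∸m≡n (x n) (d n))

y-mono-< : ∀ {m n} → m < n → y m < y n
y-mono-< {m} {n} m<n = subst₂ _<_ (sym (y≡x+d m)) (sym (y≡x+d n))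
  (+-mono-< (XY.lower-mono-< m<n) (DS.lower-mono-< m<n))

-- The greedy sequences

module Greedy (X Y : ℕ → ℕ) (greedy : IsGreedy X Y) where
  open IsGreedy greedy

  Closed : ℕ → Set
  Closed n = X (suc n) ≡ x n × Y (suc n) ≡ y n

  Y∸X≡d : ∀ {k} → Closed k → Y (suc k) ∸ X (suc k) ≡ d k
  Y∸X≡d {k} (eqX , eqY) = trans (cong₂ _∸_ eqY eqX) (y∸x≡d k)

  Y+X≡s : ∀ {k} → Closed k → Y (suc k) + X (suc k) ≡ s k
  Y+X≡s {k} (eqX , eqY) = trans (cong₂ _+_ eqY eqX) (sym (s≡y+x k))

  -- Monotonicity separates the new values from earlier ones of the same sequence, complementarity
  -- from those of the partner sequence.
  good-xy : ∀ n → (∀ {k} → k < n → Closed k) → Good X Y (suc n) (x n) (y n)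
  good-xy n ih = record
    { x-positive = s≤s z≤n
    ; x<y        = x<y n
    ; x∉X        = avoid λ {k} k<n → subst (x n ≢_) (sym (proj₁ (ih k<n))) (>⇒≢ (XY.lower-mono-< k<n))
    ; x∉Y        = avoid λ {k} k<n → subst (x n ≢_) (sym (proj₂ (ih k<n))) (XY.lower≢upper n k)
    ; y∉X        = avoid λ {k} k<n → subst (y n ≢_) (sym (proj₁ (ih k<n))) (≢-sym (XY.lower≢upper k n))
    ; y∉Y        = avoid λ {k} k<n → subst (y n ≢_) (sym (proj₂ (ih k<n))) (>⇒≢ (y-mono-< k<n))
    ; diff∉diffs = avoid λ {k} k<n → subst₂ _≢_ (sym (y∸x≡d n)) (sym (Y∸X≡d (ih k<n))) (>⇒≢ (DS.lower-mono-< k<n))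
    ; diff∉sums  = avoid λ {k} k<n → subst₂ _≢_ (sym (y∸x≡d n)) (sym (Y+X≡s (ih k<n))) (DS.lower≢upper n k)
    }
    where
    avoid : ∀ {f v} → (∀ {k} → k < n → v ≢ f (suc k)) → NotIn f (suc n) v
    avoid v≢ (suc k) _ (s≤s k<n) = v≢ k<n

  closed : ∀ n → Closed n
  closed = <-rec Closed step
    where
    step : ∀ n → (∀ {k} → k < n → Closed k) → Closed n
    step zero      ih = X1 , Y1
    step n@(suc _) ih = X≡ , Y≡
      where
      open Good (good (suc n) (s≤s (s≤s z≤n))) renaming (x<y to X<Y)

      best : Good X Y (suc n) (x n) (y n)
      best = good-xy n ih

      X≮x : ¬ X (suc n) < x n
      -- Every positive value below `x n` already occurs in `X` or `Y`.
      X≮x X<x with XY.cover n _ x-positive X<x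
      ... | k , k<n , inj₁ eq = x∉X (suc k) (s≤s z≤n) (s≤s k<n) (trans eq (sym (proj₁ (ih k<n))))
      ... | k , k<n , inj₂ eq = x∉Y (suc k) (s≤s z≤n) (s≤s k<n) (trans eq (sym (proj₂ (ih k<n))))

      X≡ : X (suc n) ≡ x n
      X≡ = ≤-antisym (X-least (suc n) (s≤s (s≤s z≤n)) _ (y n) best) (≮⇒≥ X≮x)

      Y≮y : ¬ Y (suc n) < y n
      -- Since `X (suc n)` is `x n`, a smaller `Y` would give a positive difference below `d n`,
      -- hence an earlier difference or sum.
      Y≮y Y<y with DS.cover n (Y (suc n) ∸ X (suc n)) (m<n⇒0<n∸m X<Y)
        (subst₂ _<_ (cong (Y (suc n) ∸_) (sym X≡)) (y∸x≡d n)
          (∸-monoˡ-< Y<y (subst (_≤ Y (suc n)) X≡ (<⇒≤ X<Y))))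
      ... | k , k<n , inj₁ eq = diff∉diffs (suc k) (s≤s z≤n) (s≤s k<n) (trans eq (sym (Y∸X≡d (ih k<n))))
      ... | k , k<n , inj₂ eq = diff∉sums (suc k) (s≤s z≤n) (s≤s k<n) (trans eq (sym (Y+X≡s (ih k<n))))

      Y≡ : Y (suc n) ≡ y n
      Y≡ = ≤-antisym
        (Y-least (suc n) (s≤s (s≤s z≤n)) _ (subst (λ v → Good X Y (suc n) v (y n)) (sym X≡) best))
        (≮⇒≥ Y≮y)

  -- The value of `X` at `Y n`

  X∘Y : ∀ n → X (Y (suc n)) ≡ x (1 + n + σ∣ n)
  X∘Y n = trans (cong X (proj₂ (closed n))) (proj₁ (closed (1 + n + σ∣ n)))

  X+Y : ∀ n → X (suc n) + Y (suc n) ≡ x n + y n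
  X+Y n = cong₂ _+_ (proj₁ (closed n)) (proj₂ (closed n))

-- The `suc` on the left avoids truncated subtraction; `h v` decides between the two cases of the
-- theorem.
x-at-y : ∀ n → ∃ λ v → suc (x (1 + n + σ∣ n)) ≡ (x n + y n) + h v
x-at-y n with ♯a-1+n+σ∣n n
... | v , eq = v , trans (cong (λ k → 2 + ((1 + n + σ∣ n) + k)) eq) (lem n (♯ a n) (σ∣ n) (h v))
  where
  lem : ∀ n i p j → 2 + ((1 + n + p) + ((n + i) + j)) ≡ (suc (n + i) + suc (suc (n + p))) + j
  lem = solve-∀

mainTheorem1 : (X Y : ℕ → ℕ) → IsGreedy X Y → (n : ℕ) → 1 ≤ n →
    (X (Y n) ≡ X n + Y n) ⊎ (X (Y n) ≡ (X n + Y n) ∸ 1)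
mainTheorem1 X Y greedy (suc n) _ = split-h (x-at-y n)
  where
  open Greedy X Y greedy
  split-h : (∃ λ v → suc (x (1 + n + σ∣ n)) ≡ (x n + y n) + h v) →
    (X (Y (suc n)) ≡ X (suc n) + Y (suc n)) ⊎ (X (Y (suc n)) ≡ (X (suc n) + Y (suc n)) ∸ 1)
  split-h (v , eq) rewrite X∘Y n | X+Y n with h v | h≤1 v
  ... | _ | inj₁ refl = inj₂ (cong (_∸ 1) (trans eq (+-identityʳ _)))
  ... | _ | inj₂ refl = inj₁ (suc-injective (trans eq (+-comm _ 1)))
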